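{- If a nested sequent $\Gamma$ is derivable in $\mathsf{N.IntCK}\cup\{\mathsf{cut}\}$, then $\Gamma$ is derivable in $\mathsf{N.IntCK}$.
   Context: Language $\mathcal{L}$: formulas $\varphi ::= p \mid \bot \mid \varphi\wedge\varphi \mid \varphi\vee\varphi \mid \varphi\to\varphi \mid \varphi \mathbin{\Box\!\!\rightarrow} \varphi \mid \varphi \mathbin{\Diamond\!\!\rightarrow}\varphi$. Nested sequents: for each $\varphi\in\mathcal{L}$ there is an input formula $\bullet\varphi$ and an output formula $\circ\varphi$. Input sequents $\Lambda ::= \emptyset \mid \Lambda,\bullet\varphi \mid \Lambda,[\psi:\Lambda']$; nested sequents $\Gamma ::= \Lambda,\circ\varphi \mid \Lambda,[\psi:\Gamma']$, with $\psi\in\mathcal{L}$ the index of the component, comma being multiset union; a nested sequent contains exactly one output formula. A context $\Gamma\{\,\}$ is built by: $\{\,\}$ is a context; if $\Delta$ is a (input or nested) sequent and $\Gamma\{\,\}$ a context then $\Delta,\Gamma\{\,\}$ and $[\varphi:\Gamma\{\,\}]$ are contexts. $\Gamma\{\Sigma\}$ fills the hole with $\Sigma$; only fillings yielding input or nested sequents are allowed. $\Gamma^{\downarrow}\{\,\}$ is $\Gamma\{\,\}$ with its output formula (if any) deleted. Rules of $\mathsf{N.IntCK}$ (premisses / conclusion): init: $\Gamma\{\bullet p,\circ p\}$; $\bot^\bullet$: $\Gamma\{\bullet\bot\}$; $\wedge^\bullet$: $\Gamma\{\bullet\varphi,\bullet\psi\}$ / $\Gamma\{\bullet(\varphi\wedge\psi)\}$;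 $\wedge^\circ$: $\Gamma\{\circ\varphi\}$, $\Gamma\{\circ\psi\}$ / $\Gamma\{\circ(\varphi\wedge\psi)\}$; $\vee^\bullet$: $\Gamma\{\bullet\varphi\}$, $\Gamma\{\bullet\psi\}$ / $\Gamma\{\bullet(\varphi\vee\psi)\}$; $\vee^\circ$: $\Gamma\{\circ\varphi\}$ / $\Gamma\{\circ(\varphi\vee\psi)\}$ and $\Gamma\{\circ\psi\}$ / $\Gamma\{\circ(\varphi\vee\psi)\}$; $\to^\bullet$: $\Gamma^\downarrow\{\bullet(\varphi\to\psi),\circ\varphi\}$, $\Gamma\{\bullet\psi\}$ / $\Gamma\{\bullet(\varphi\to\psi)\}$; $\to^\circ$: $\Gamma\{\bullet\varphi,\circ\psi\}$ / $\Gamma\{\circ(\varphi\to\psi)\}$; $\Box^\bullet$: $\bullet\varphi,\circ\eta$; $\bullet\eta,\circ\varphi$; $\Gamma\{\bullet(\varphi\mathbin{\Box\!\!\rightarrow}\psi),[\eta:\bullet\psi,\Delta]\}$ / $\Gamma\{\bullet(\varphi\mathbin{\Box\!\!\rightarrow}\psi),[\eta:\Delta]\}$; $\Box^\circ$: $\Gamma\{[\varphi:\circ\psi]\}$ / $\Gamma\{\circ(\varphi\mathbin{\Box\!\!\rightarrow}\psi)\}$; $\Diamond^\bullet$: $\Gamma\{[\varphi:\bullet\psi]\}$ / $\Gamma\{\bullet(\varphi\mathbin{\Diamond\!\!\rightarrow}\psi)\}$; $\Diamond^\circ$: $\bullet\varphi,\circ\eta$; $\bullet\eta,\circ\varphi$;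 $\Gamma\{[\eta:\circ\psi,\Delta]\}$ / $\Gamma\{\circ(\varphi\mathbin{\Diamond\!\!\rightarrow}\psi),[\eta:\Delta]\}$. Derivations are finite trees with leaves instances of init or $\bot^\bullet$. The rule cut is: $\Gamma^\downarrow\{\circ\xi\}$, $\Gamma\{\bullet\xi\}$ / $\Gamma\{\emptyset\}$. -}

module Defs where

open import Data.Nat using (ℕ; zero; suc; _+_)
open import Data.List using (List; []; _∷_; _++_; [_])
open import Relation.Binary.PropositionalEquality using (_≡_)

infixr 6 _∧'_
infixr 5 _∨'_
infixr 4 _⇒_ _□→_ _◇→_

data Fm : Set where
  atom : ℕ → Fm
  ⊥'   : Fm
  _∧'_ _∨'_ _⇒_ _□→_ _◇→_ : Fm → Fm → Fm

-- Nested sequents, represented as lists of items (comma = list append,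
-- read modulo the deep multiset equivalence _∼_ below).

infix 8 •_ ◦_
data Item : Set where
  •_    : Fm → Item
  ◦_    : Fm → Item
  [_∶_] : Fm → List Item → Item

Seq : Set
Seq = List Item

outs : Seq → ℕ
outs []                  = 0
outs ((• φ) ∷ xs)        = outs xs
outs ((◦ φ) ∷ xs)        = suc (outs xs)
outs ([ ψ ∶ Δ ] ∷ xs)    = outs Δ + outs xs

InputSeq : Seq → Set
InputSeq Γ = outs Γ ≡ 0

NestedSeq : Seq → Set
NestedSeq Γ = outs Γ ≡ 1

eraseOut : Seq → Seq
eraseOut []               = []
eraseOut ((• φ) ∷ xs)     = (• φ) ∷ eraseOut xs
eraseOut ((◦ φ) ∷ xs)     = eraseOut xs
eraseOut ([ ψ ∶ Δ ] ∷ xs) = [ ψ ∶ eraseOut Δ ] ∷ eraseOut xs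

data _∼_ : Seq → Seq → Set
data _∼ᵢ_ : Item → Item → Set

data _∼ᵢ_ where
  •-cong : ∀ {φ} → (• φ) ∼ᵢ (• φ)
  ◦-cong : ∀ {φ} → (◦ φ) ∼ᵢ (◦ φ)
  []-cong : ∀ {ψ Δ Δ'} → Δ ∼ Δ' → [ ψ ∶ Δ ] ∼ᵢ [ ψ ∶ Δ' ]

data _∼_ where
  nil   : [] ∼ []
  cons  : ∀ {x y xs ys} → x ∼ᵢ y → xs ∼ ys → (x ∷ xs) ∼ (y ∷ ys)
  swap  : ∀ {x y xs} → (x ∷ y ∷ xs) ∼ (y ∷ x ∷ xs)
  trans : ∀ {xs ys zs} → xs ∼ ys → ys ∼ zs → xs ∼ zs

data Ctx : Set where
  hole : Ctx
  _,,_ : Seq → Ctx → Ctx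
  [_∶∶_] : Fm → Ctx → Ctx

infix 3 _⟪_⟫
_⟪_⟫ : Ctx → Seq → Seq
hole ⟪ Σ ⟫        = Σ
(Δ ,, C) ⟪ Σ ⟫    = Δ ++ (C ⟪ Σ ⟫)
[ φ ∶∶ C ] ⟪ Σ ⟫  = [ [ φ ∶ C ⟪ Σ ⟫ ] ]

_↓ : Ctx → Ctx
hole ↓       = hole
(Δ ,, C) ↓   = eraseOut Δ ,, (C ↓)
[ φ ∶∶ C ] ↓ = [ φ ∶∶ (C ↓) ]

data Calc : Set where
  cutFree withCut : Calc

infix 1 ⊢[_]_
data ⊢[_]_ : Calc → Seq → Set where
  -- sequents are multisets (at every depth)
  exch : ∀ {c Γ Γ'} → Γ ∼ Γ' → ⊢[ c ] Γ → ⊢[ c ] Γ'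
  init : ∀ {c} (G : Ctx) (p : ℕ) → ⊢[ c ] G ⟪ (• atom p) ∷ (◦ atom p) ∷ [] ⟫
  ⊥•   : ∀ {c} (G : Ctx) → ⊢[ c ] G ⟪ [ • ⊥' ] ⟫
  ∧•   : ∀ {c} (G : Ctx) φ ψ →
         ⊢[ c ] G ⟪ (• φ) ∷ (• ψ) ∷ [] ⟫ →
         ⊢[ c ] G ⟪ [ • (φ ∧' ψ) ] ⟫
  ∧◦   : ∀ {c} (G : Ctx) φ ψ →
         ⊢[ c ] G ⟪ [ ◦ φ ] ⟫ → ⊢[ c ] G ⟪ [ ◦ ψ ] ⟫ →
         ⊢[ c ] G ⟪ [ ◦ (φ ∧' ψ) ] ⟫
  ∨•   : ∀ {c} (G : Ctx) φ ψ →
         ⊢[ c ] G ⟪ [ • φ ] ⟫ → ⊢[ c ] G ⟪ [ • ψ ] ⟫ →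
         ⊢[ c ] G ⟪ [ • (φ ∨' ψ) ] ⟫
  ∨◦₁  : ∀ {c} (G : Ctx) φ ψ →
         ⊢[ c ] G ⟪ [ ◦ φ ] ⟫ → ⊢[ c ] G ⟪ [ ◦ (φ ∨' ψ) ] ⟫
  ∨◦₂  : ∀ {c} (G : Ctx) φ ψ →
         ⊢[ c ] G ⟪ [ ◦ ψ ] ⟫ → ⊢[ c ] G ⟪ [ ◦ (φ ∨' ψ) ] ⟫
  ⇒•   : ∀ {c} (G : Ctx) φ ψ →
         ⊢[ c ] (G ↓) ⟪ (• (φ ⇒ ψ)) ∷ (◦ φ) ∷ [] ⟫ →
         ⊢[ c ] G ⟪ [ • ψ ] ⟫ →
         ⊢[ c ] G ⟪ [ • (φ ⇒ ψ) ] ⟫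
  ⇒◦   : ∀ {c} (G : Ctx) φ ψ →
         ⊢[ c ] G ⟪ (• φ) ∷ (◦ ψ) ∷ [] ⟫ →
         ⊢[ c ] G ⟪ [ ◦ (φ ⇒ ψ) ] ⟫
  □•   : ∀ {c} (G : Ctx) φ ψ η (Δ : Seq) →
         ⊢[ c ] ((• φ) ∷ (◦ η) ∷ []) →
         ⊢[ c ] ((• η) ∷ (◦ φ) ∷ []) →
         ⊢[ c ] G ⟪ (• (φ □→ ψ)) ∷ [ η ∶ (• ψ) ∷ Δ ] ∷ [] ⟫ →
         ⊢[ c ] G ⟪ (• (φ □→ ψ)) ∷ [ η ∶ Δ ] ∷ [] ⟫
  □◦   : ∀ {c} (G : Ctx) φ ψ →
         ⊢[ c ] G ⟪ [ [ φ ∶ [ ◦ ψ ] ] ] ⟫ →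
         ⊢[ c ] G ⟪ [ ◦ (φ □→ ψ) ] ⟫
  ◇•   : ∀ {c} (G : Ctx) φ ψ →
         ⊢[ c ] G ⟪ [ [ φ ∶ [ • ψ ] ] ] ⟫ →
         ⊢[ c ] G ⟪ [ • (φ ◇→ ψ) ] ⟫
  ◇◦   : ∀ {c} (G : Ctx) φ ψ η (Δ : Seq) →
         ⊢[ c ] ((• φ) ∷ (◦ η) ∷ []) →
         ⊢[ c ] ((• η) ∷ (◦ φ) ∷ []) →
         ⊢[ c ] G ⟪ [ [ η ∶ (◦ ψ) ∷ Δ ] ] ⟫ →
         ⊢[ c ] G ⟪ (◦ (φ ◇→ ψ)) ∷ [ η ∶ Δ ] ∷ [] ⟫
  cut  : ∀ (G : Ctx) ξ →
         ⊢[ withCut ] (G ↓) ⟪ [ ◦ ξ ] ⟫ →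
         ⊢[ withCut ] G ⟪ [ • ξ ] ⟫ →
         ⊢[ withCut ] G ⟪ [] ⟫

{-# OPTIONS --safe #-}
module Submission where

-- Semantic cut elimination in the style of Okada.  Worlds are trees of input
-- items, and ⟦ φ ⟧ is a predicate on the nodes of worlds with
--     • φ at w  ⇒  ⟦ φ ⟧ at w  ⇒  ◦ φ at w is derivable without cut,
-- written ⟦ φ ⟧ ∝ φ.  Conditionals follow an edge with index η along a
-- predicate X whenever X ∝ η; this relation depends on X only up to
-- equivalence, so replacing an index by an equivalent one is sound without any
-- cut on indices, and since φ itself satisfies ⟦ φ ⟧ ∝ φ, the cut-free rules for
-- □→ and ◇→ suffice for the two implications above.  All rules, including
-- cut, are sound in this model; evaluating a derivation of Γ in the world given
-- by Γ itself yields a cut-free derivation.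

open import Defs
open import Data.Empty using (⊥; ⊥-elim)
open import Data.Fin using (Fin; zero; suc; _≟_)
open import Data.List using ([]; _∷_; _++_; [_])
open import Data.List.Membership.Propositional using (_∈_)
open import Data.List.Membership.Propositional.Properties using (∈-++⁺ˡ; ∈-++⁺ʳ)
open import Data.List.Properties using (++-assoc; ++-identityʳ)
open import Data.List.Relation.Binary.Permutation.Propositional as Perm using (_↭_; ↭-sym)
open import Data.List.Relation.Binary.Permutation.Propositional.Properties using (shift; ++-comm)
open import Data.List.Relation.Unary.All as All using (All; []; _∷_)
open import Data.List.Relation.Unary.Any using (here; there)
open import Data.Nat using (ℕ; zero; suc; _+_)
open import Data.Nat.Properties using (+-assoc; +-comm; +-identityʳ; m+n≡0⇒m≡0; m+n≡0⇒n≡0; suc-injective)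
open import Data.Product using (Σ-syntax; _×_; _,_; proj₁; proj₂)
open import Data.Sum using (_⊎_; inj₁; inj₂; map₂)
open import Data.Unit using (⊤; tt)
open import Data.Vec.Functional using (updateAt)
open import Data.Vec.Functional.Properties using (updateAt-updates; updateAt-minimal)
open import Function using (_∘_; const; id)
open import Relation.Binary.PropositionalEquality using (_≡_; _≢_; refl; sym; cong; cong₂; subst; ≢-sym) renaming (trans to ≡-trans)
open import Relation.Nullary using (yes; no)

variable
  n : ℕ
  Γ Δ : Seq

-- Deep multiset equivalence, composition of contexts and erasure of outputs.

mutual
  ∼-refl : ∀ Γ → Γ ∼ Γ
  ∼-refl []      = nil
  ∼-refl (x ∷ Γ) = cons (∼ᵢ-refl x) (∼-refl Γ)

  ∼ᵢ-refl : ∀ x → x ∼ᵢ x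
  ∼ᵢ-refl (• φ)     = •-cong
  ∼ᵢ-refl (◦ φ)     = ◦-cong
  ∼ᵢ-refl [ η ∶ Δ ] = []-cong (∼-refl Δ)

mutual
  ∼-sym : Γ ∼ Δ → Δ ∼ Γ
  ∼-sym nil         = nil
  ∼-sym (cons e es) = cons (∼ᵢ-sym e) (∼-sym es)
  ∼-sym swap        = swap
  ∼-sym (trans e f) = trans (∼-sym f) (∼-sym e)

  ∼ᵢ-sym : ∀ {x y} → x ∼ᵢ y → y ∼ᵢ x
  ∼ᵢ-sym •-cong      = •-cong
  ∼ᵢ-sym ◦-cong      = ◦-cong
  ∼ᵢ-sym ([]-cong e) = []-cong (∼-sym e)

≡⇒∼ : Γ ≡ Δ → Γ ∼ Δ
≡⇒∼ {Γ} refl = ∼-refl Γ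

↭⇒∼ : Γ ↭ Δ → Γ ∼ Δ
↭⇒∼ {Γ} Perm.refl        = ∼-refl Γ
↭⇒∼ (Perm.prep x p)      = cons (∼ᵢ-refl x) (↭⇒∼ p)
↭⇒∼ (Perm.swap x y p)    = trans swap (cons (∼ᵢ-refl y) (cons (∼ᵢ-refl x) (↭⇒∼ p)))
↭⇒∼ (Perm.trans p q)     = trans (↭⇒∼ p) (↭⇒∼ q)

∼-++ˡ : ∀ Θ → Γ ∼ Δ → (Θ ++ Γ) ∼ (Θ ++ Δ)
∼-++ˡ []      e = e
∼-++ˡ (x ∷ Θ) e = cons (∼ᵢ-refl x) (∼-++ˡ Θ e)

∼-++ʳ : ∀ Θ → Γ ∼ Δ → (Γ ++ Θ) ∼ (Δ ++ Θ)
∼-++ʳ Θ nil         = ∼-refl Θ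
∼-++ʳ Θ (cons e es) = cons e (∼-++ʳ Θ es)
∼-++ʳ Θ swap        = swap
∼-++ʳ Θ (trans e f) = trans (∼-++ʳ Θ e) (∼-++ʳ Θ f)

⟪⟫-cong : ∀ G → Γ ∼ Δ → (G ⟪ Γ ⟫) ∼ (G ⟪ Δ ⟫)
⟪⟫-cong hole        e = e
⟪⟫-cong (Θ ,, G)    e = ∼-++ˡ Θ (⟪⟫-cong G e)
⟪⟫-cong [ η ∶∶ G ]  e = cons ([]-cong (⟪⟫-cong G e)) nil

infixr 5 _⊙_
_⊙_ : Ctx → Ctx → Ctx
hole       ⊙ H = H
(Δ ,, G)   ⊙ H = Δ ,, (G ⊙ H)
[ η ∶∶ G ] ⊙ H = [ η ∶∶ G ⊙ H ]

⊙-⟪⟫ : ∀ G H Γ → (G ⊙ H ⟪ Γ ⟫) ≡ (G ⟪ H ⟪ Γ ⟫ ⟫)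
⊙-⟪⟫ hole       H Γ = refl
⊙-⟪⟫ (Δ ,, G)   H Γ = cong (Δ ++_) (⊙-⟪⟫ G H Γ)
⊙-⟪⟫ [ η ∶∶ G ] H Γ = cong (λ Δ → [ [ η ∶ Δ ] ]) (⊙-⟪⟫ G H Γ)

⊙-↓ : ∀ G H → (G ⊙ H) ↓ ≡ (G ↓) ⊙ (H ↓)
⊙-↓ hole       H = refl
⊙-↓ (Δ ,, G)   H = cong (eraseOut Δ ,,_) (⊙-↓ G H)
⊙-↓ [ η ∶∶ G ] H = cong [ η ∶∶_] (⊙-↓ G H)

eraseOut-++ : ∀ Γ Δ → eraseOut (Γ ++ Δ) ≡ eraseOut Γ ++ eraseOut Δ
eraseOut-++ []              Δ = refl
eraseOut-++ ((• φ) ∷ Γ)     Δ = cong ((• φ) ∷_) (eraseOut-++ Γ Δ)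
eraseOut-++ ((◦ φ) ∷ Γ)     Δ = eraseOut-++ Γ Δ
eraseOut-++ ([ η ∶ Θ ] ∷ Γ) Δ = cong ([ η ∶ eraseOut Θ ] ∷_) (eraseOut-++ Γ Δ)

eraseOut-idem : ∀ Γ → eraseOut (eraseOut Γ) ≡ eraseOut Γ
eraseOut-idem []              = refl
eraseOut-idem ((• φ) ∷ Γ)     = cong ((• φ) ∷_) (eraseOut-idem Γ)
eraseOut-idem ((◦ φ) ∷ Γ)     = eraseOut-idem Γ
eraseOut-idem ([ η ∶ Δ ] ∷ Γ) = cong₂ (λ Δ Γ → [ η ∶ Δ ] ∷ Γ) (eraseOut-idem Δ) (eraseOut-idem Γ)

eraseOut-input : ∀ Γ → InputSeq Γ → eraseOut Γ ≡ Γ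
eraseOut-input []              _ = refl
eraseOut-input ((• φ) ∷ Γ)     i = cong ((• φ) ∷_) (eraseOut-input Γ i)
eraseOut-input ([ η ∶ Δ ] ∷ Γ) i =
  cong₂ (λ Δ Γ → [ η ∶ Δ ] ∷ Γ) (eraseOut-input Δ (m+n≡0⇒m≡0 (outs Δ) i)) (eraseOut-input Γ (m+n≡0⇒n≡0 (outs Δ) i))

eraseOut-∼ : Γ ∼ Δ → eraseOut Γ ∼ eraseOut Δ
eraseOut-∼ nil                       = nil
eraseOut-∼ (cons •-cong e)           = cons •-cong (eraseOut-∼ e)
eraseOut-∼ (cons ◦-cong e)           = eraseOut-∼ e
eraseOut-∼ (cons ([]-cong e) f)      = cons ([]-cong (eraseOut-∼ e)) (eraseOut-∼ f)
eraseOut-∼ (swap {x} {y} {Γ})        = ↭⇒∼ (swapped x y)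
  where
  swapped : ∀ x y → eraseOut (x ∷ y ∷ Γ) ↭ eraseOut (y ∷ x ∷ Γ)
  swapped (• _)     (• _)     = Perm.swap _ _ Perm.refl
  swapped (• _)     (◦ _)     = Perm.refl
  swapped (• _)     [ _ ∶ _ ] = Perm.swap _ _ Perm.refl
  swapped (◦ _)     (• _)     = Perm.refl
  swapped (◦ _)     (◦ _)     = Perm.refl
  swapped (◦ _)     [ _ ∶ _ ] = Perm.refl
  swapped [ _ ∶ _ ] (• _)     = Perm.swap _ _ Perm.refl
  swapped [ _ ∶ _ ] (◦ _)     = Perm.refl
  swapped [ _ ∶ _ ] [ _ ∶ _ ] = Perm.swap _ _ Perm.refl
eraseOut-∼ (trans e f)               = trans (eraseOut-∼ e) (eraseOut-∼ f)

-- Finite trees and the contexts around their nodes and edges.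

-- Node zero of grow τ p η is a new leaf, attached to node p of τ by an edge with index η.
data Shape : ℕ → Set where
  leaf : Shape 1
  grow : Shape n → Fin n → Fm → Shape (suc n)

data Edge : Shape n → Fin n → Fm → Fin n → Set where
  new : ∀ {τ : Shape n} {p η} → Edge (grow τ p η) (suc p) η zero
  old : ∀ {τ : Shape n} {p η w ζ v} → Edge τ w ζ v → Edge (grow τ p η) (suc w) ζ (suc v)

edge-irrefl : ∀ {τ : Shape n} {w η v} → Edge τ w η v → w ≢ v
edge-irrefl new     ()
edge-irrefl (old e) refl = edge-irrefl e refl

-- The newest node is always a leaf, so it can be folded into the content of its parent before the
-- older nodes are treated.
flatten : Shape n → (Fin n → Seq) → Seq
flatten leaf         d = d zero
flatten (grow τ p η) d = flatten τ (updateAt (d ∘ suc) p ([ η ∶ d zero ] ∷_))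

updateAt-agree : ∀ (d d' : Fin n → Seq) p {x x'} → x ∼ᵢ x' → ∀ u → d u ∼ d' u →
                 updateAt d p (x ∷_) u ∼ updateAt d' p (x' ∷_) u
updateAt-agree d d' p {x} {x'} e u f with u ≟ p
... | yes refl = trans (≡⇒∼ (updateAt-updates p d)) (trans (cons e f) (≡⇒∼ (sym (updateAt-updates p d'))))
... | no u≢p   = trans (≡⇒∼ (updateAt-minimal u p d u≢p)) (trans f (≡⇒∼ (sym (updateAt-minimal u p d' u≢p))))

-- `G` must not depend on the content at `w`: the premisses and the conclusion of a rule differ
-- there and have to be fillings of one and the same context.
record Focuses (τ : Shape n) (d : Fin n → Seq) (w : Fin n) (G : Ctx) : Set where
  constructor focusing
  field refocus : ∀ d' → (∀ u → u ≢ w → d' u ∼ d u) → flatten τ d' ∼ (G ⟪ d' w ⟫)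

open Focuses

module _ (τ : Shape n) (p : Fin n) (η : Fm) (d : Fin (suc n) → Seq) where

  private
    e : Fin n → Seq
    e = updateAt (d ∘ suc) p ([ η ∶ d zero ] ∷_)

  focuses-parent : ∀ {G} → Focuses τ e p G → Focuses (grow τ p η) d (suc p) (G ⊙ ([ [ η ∶ d zero ] ] ,, hole))
  focuses-parent {G} F = focusing λ d' a → let open Aux d' a in trans (refocus F _ off) (trans (⟪⟫-cong G at-p) (≡⇒∼ (sym (⊙-⟪⟫ G _ _))))
    where
    module Aux (d' : Fin (suc n) → Seq) (a : ∀ u → u ≢ suc p → d' u ∼ d u) where
      z : d' zero ∼ d zero
      z = a zero λ ()
      off : ∀ u → u ≢ p → _
      off u u≢p = updateAt-agree (d' ∘ suc) (d ∘ suc) p ([]-cong z) u (a (suc u) λ { refl → u≢p refl })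
      at-p : updateAt (d' ∘ suc) p ([ η ∶ d' zero ] ∷_) p ∼ ([ η ∶ d zero ] ∷ d' (suc p))
      at-p = trans (≡⇒∼ (updateAt-updates p (d' ∘ suc))) (cons ([]-cong z) (∼-refl _))

  focuses-other : ∀ {G w} → w ≢ p → Focuses τ e w G → Focuses (grow τ p η) d (suc w) G
  focuses-other {G} {w} w≢p F = focusing λ d' a → let open Aux d' a in
    trans (refocus F _ off) (⟪⟫-cong G (≡⇒∼ (updateAt-minimal w p (d' ∘ suc) w≢p)))
    where
    module Aux (d' : Fin (suc n) → Seq) (a : ∀ u → u ≢ suc w → d' u ∼ d u) where
      off : ∀ u → u ≢ w → _
      off u u≢w = updateAt-agree (d' ∘ suc) (d ∘ suc) p ([]-cong (a zero λ ())) u (a (suc u) λ { refl → u≢w refl })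

  focuses-new : ∀ {G} → Focuses τ e p G → Focuses (grow τ p η) d zero (G ⊙ (d (suc p) ,, [ η ∶∶ hole ]))
  focuses-new {G} F = focusing λ d' a → let open Aux d' a in trans (refocus F _ off) (trans (⟪⟫-cong G at-p) (≡⇒∼ (sym (⊙-⟪⟫ G _ _))))
    where
    module Aux (d' : Fin (suc n) → Seq) (a : ∀ u → u ≢ zero → d' u ∼ d u) where
      off' : ∀ u → d' (suc u) ∼ d (suc u)
      off' u = a (suc u) λ ()
      off : ∀ u → u ≢ p → updateAt (d' ∘ suc) p ([ η ∶ d' zero ] ∷_) u ∼ e u
      off u u≢p = trans (≡⇒∼ (updateAt-minimal u p (d' ∘ suc) u≢p))
                    (trans (off' u) (≡⇒∼ (sym (updateAt-minimal u p (d ∘ suc) u≢p))))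
      at-p : updateAt (d' ∘ suc) p ([ η ∶ d' zero ] ∷_) p ∼ (d (suc p) ++ [ [ η ∶ d' zero ] ])
      at-p = trans (≡⇒∼ (updateAt-updates p (d' ∘ suc)))
               (trans (cons (∼ᵢ-refl _) (off' p)) (↭⇒∼ (++-comm [ [ η ∶ d' zero ] ] (d (suc p)))))

focuses-cong : ∀ {τ : Shape n} {d d' w G} → (∀ u → u ≢ w → d' u ∼ d u) → Focuses τ d w G → Focuses τ d' w G
focuses-cong a F = focusing λ d'' a' → refocus F d'' λ u u≢w → trans (a' u u≢w) (a u u≢w)

eraseOut-updateAt : ∀ (d : Fin n → Seq) p η Δ u →
  updateAt (eraseOut ∘ d) p ([ η ∶ eraseOut Δ ] ∷_) u ∼ eraseOut (updateAt d p ([ η ∶ Δ ] ∷_) u)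
eraseOut-updateAt d p η Δ u with u ≟ p
... | yes refl = ≡⇒∼ (≡-trans (updateAt-updates p (eraseOut ∘ d)) (cong eraseOut (sym (updateAt-updates p d))))
... | no u≢p   = ≡⇒∼ (≡-trans (updateAt-minimal u p (eraseOut ∘ d) u≢p) (cong eraseOut (sym (updateAt-minimal u p d u≢p))))

-- Both contexts come out of one recursion, so that erasing all contents gives exactly `G ↓`. This
-- links the two premisses of `⇒•`, whose goals may lie at different nodes.
focus : ∀ (τ : Shape n) d w → Σ[ G ∈ Ctx ] Focuses τ d w G × Focuses τ (eraseOut ∘ d) w (G ↓)
focus leaf d zero = hole , focusing (λ d' _ → ∼-refl _) , focusing (λ d' _ → ∼-refl _)
focus (grow τ p η) d (suc w) with w ≟ p
... | yes refl = let (G , F , F↓) = focus τ _ p in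
  _ , focuses-parent τ p η d F ,
  subst (Focuses (grow τ p η) (eraseOut ∘ d) (suc p)) (sym (⊙-↓ G _))
    (focuses-parent τ p η (eraseOut ∘ d) (focuses-cong (λ u _ → eraseOut-updateAt (d ∘ suc) p η (d zero) u) F↓))
... | no w≢p = let (G , F , F↓) = focus τ _ w in
  G , focuses-other τ p η d w≢p F ,
  focuses-other τ p η (eraseOut ∘ d) w≢p (focuses-cong (λ u _ → eraseOut-updateAt (d ∘ suc) p η (d zero) u) F↓)
focus (grow τ p η) d zero = let (G , F , F↓) = focus τ _ p in
  _ , focuses-new τ p η d F ,
  subst (Focuses (grow τ p η) (eraseOut ∘ d) zero) (sym (⊙-↓ G _))
    (focuses-new τ p η (eraseOut ∘ d) (focuses-cong (λ u _ → eraseOut-updateAt (d ∘ suc) p η (d zero) u) F↓))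

agree-off-edge : ∀ (d d' : Fin (suc n) → Seq) p ζ {w v} →
  (∀ u → u ≢ suc w → u ≢ suc v → d' u ∼ d u) → ∀ u → u ≢ w → u ≢ v →
  updateAt (d' ∘ suc) p ([ ζ ∶ d' zero ] ∷_) u ∼ updateAt (d ∘ suc) p ([ ζ ∶ d zero ] ∷_) u
agree-off-edge d d' p ζ a u u≢w u≢v = updateAt-agree (d' ∘ suc) (d ∘ suc) p ([]-cong (a zero (λ ()) λ ())) u
  (a (suc u) (λ { refl → u≢w refl }) λ { refl → u≢v refl })

-- The rules `□•` and `◇◦` involve both ends of an edge, so both contents vary at once. `Δ` collects
-- what the descendants of `v` contribute to its component. A later leaf enlarges the context if
-- attached to `w` and `Δ` if attached to `v`; it cannot be attached to both, since the ends of an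
-- edge differ.
focus-edge : ∀ {τ : Shape n} d {w η v} → Edge τ w η v → Σ[ G ∈ Ctx ] Σ[ Δ ∈ Seq ]
  (∀ d' → (∀ u → u ≢ w → u ≢ v → d' u ∼ d u) → flatten τ d' ∼ (G ⟪ d' w ++ [ [ η ∶ d' v ++ Δ ] ] ⟫))
focus-edge d (new {τ = τ} {p} {η}) = let (G , F , _) = focus τ (d ∘ suc) p in
  G , [] , λ d' a →
    trans (refocus F _ λ u u≢p → trans (≡⇒∼ (updateAt-minimal u p (d' ∘ suc) u≢p)) (a (suc u) (λ { refl → u≢p refl }) λ ()))
      (⟪⟫-cong G (trans (≡⇒∼ (updateAt-updates p (d' ∘ suc)))
        (trans (cons ([]-cong (≡⇒∼ (sym (++-identityʳ (d' zero))))) (∼-refl _)) (↭⇒∼ (++-comm [ _ ] (d' (suc p)))))))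
focus-edge {n = suc n} d (old {τ = τ} {p} {ζ} {w} {η} {v} ε)
  with focus-edge (updateAt (d ∘ suc) p ([ ζ ∶ d zero ] ∷_)) ε | p ≟ w | p ≟ v
... | G , Δ , F | yes refl | yes refl = ⊥-elim (edge-irrefl ε refl)
... | G , Δ , F | yes refl | no p≢v =
  G ⊙ ([ [ ζ ∶ d zero ] ] ,, hole) , Δ , λ d' a →
    trans (F _ (agree-off-edge d d' p ζ a))
      (trans (⟪⟫-cong G (trans
         (≡⇒∼ (cong₂ (λ A B → A ++ [ [ η ∶ B ++ Δ ] ])
           (updateAt-updates p (d' ∘ suc)) (updateAt-minimal v p (d' ∘ suc) (≢-sym p≢v))))
         (cons ([]-cong (a zero (λ ()) λ ())) (∼-refl _))))
        (≡⇒∼ (sym (⊙-⟪⟫ G _ _))))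
... | G , Δ , F | no p≢w | yes refl =
  G , [ ζ ∶ d zero ] ∷ Δ , λ d' a →
    trans (F _ (agree-off-edge d d' p ζ a))
      (⟪⟫-cong G (trans
         (≡⇒∼ (cong₂ (λ A B → A ++ [ [ η ∶ B ++ Δ ] ])
           (updateAt-minimal w p (d' ∘ suc) (≢-sym p≢w)) (updateAt-updates p (d' ∘ suc))))
         (∼-++ˡ (d' (suc w)) (cons ([]-cong
            (trans (cons ([]-cong (a zero (λ ()) λ ())) (∼-refl _)) (↭⇒∼ (↭-sym (shift _ (d' (suc v)) Δ))))) nil))))
... | G , Δ , F | no p≢w | no p≢v =
  G , Δ , λ d' a →
    trans (F _ (agree-off-edge d d' p ζ a))
      (⟪⟫-cong G
         (≡⇒∼ (cong₂ (λ A B → A ++ [ [ η ∶ B ++ Δ ] ])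
           (updateAt-minimal w p (d' ∘ suc) (≢-sym p≢w)) (updateAt-minimal v p (d' ∘ suc) (≢-sym p≢v)))))

-- Worlds and cut-free derivability at a node.

record World : Set where
  constructor world
  field
    {size} : ℕ
    shape  : Shape size
    cont   : Fin size → Seq

open World

Node : World → Set
Node S = Fin (size S)

at : Fin n → Seq → Fin n → Seq
at v Ξ = updateAt (const []) v (const Ξ)

at-here : ∀ (v : Fin n) Ξ → at v Ξ v ≡ Ξ
at-here v Ξ = updateAt-updates v (const [])

at-away : ∀ (v : Fin n) Ξ {u} → u ≢ v → at v Ξ u ≡ []
at-away v Ξ {u} = updateAt-minimal u v (const [])

eraseOut-at : ∀ (v : Fin n) χ u → eraseOut (at v [ ◦ χ ] u) ≡ []
eraseOut-at v χ u with u ≟ v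
... | yes refl = cong eraseOut (at-here v [ ◦ χ ])
... | no u≢v   = cong eraseOut (at-away v [ ◦ χ ] u≢v)

-- Contents are erased so that worlds may hold arbitrary sequents while only Ξ contributes outputs.
deco : (S : World) → Node S → Seq → Node S → Seq
deco S v Ξ u = at v Ξ u ++ eraseOut (cont S u)

-- A record rather than a synonym, so that `S`, `v` and `Ξ` can be read off the type; `flatten` is
-- not injective.
record Derivable (S : World) (v : Node S) (Ξ : Seq) : Set where
  constructor derive
  field derivation : ⊢[ cutFree ] flatten (shape S) (deco S v Ξ)

open Derivable

infix 2 _⊢_∶_
_⊢_∶_ : (S : World) → Node S → Fm → Set
S ⊢ v ∶ χ = Derivable S v [ ◦ χ ]

set : (S : World) → Node S → Seq → World
set S w Θ = world (shape S) (updateAt (cont S) w (const Θ))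

push : (S : World) → Node S → Seq → World
push S w Θ = set S w (Θ ++ cont S w)

extend : (S : World) → Node S → Fm → Seq → World
extend S w η Δ = world (grow (shape S) w η) λ { zero → Δ ; (suc u) → cont S u }

-- Coverage and the accessibility relation between worlds.

-- The left rules consume their principal formula, so a world cannot simply grow
-- along ⊑: an item counts as covered if it is present or has been decomposed.
data Cov (S : World) : Node S → Item → Set where
  here  : ∀ {w x} → x ∈ cont S w → Cov S w x
  ∧-cov : ∀ {w φ ψ} → Cov S w (• φ) → Cov S w (• ψ) → Cov S w (• (φ ∧' ψ))
  ∨-cov₁ : ∀ {w φ ψ} → Cov S w (• φ) → Cov S w (• (φ ∨' ψ))
  ∨-cov₂ : ∀ {w φ ψ} → Cov S w (• ψ) → Cov S w (• (φ ∨' ψ))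
  ⇒-cov : ∀ {w φ ψ} → Cov S w (• ψ) → Cov S w (• (φ ⇒ ψ))
  ◇-cov : ∀ {w φ ψ v} → Edge (shape S) w φ v → Cov S v (• ψ) → Cov S w (• (φ ◇→ ψ))
  []-cov : ∀ {w η v Δ} → Edge (shape S) w η v → All (Cov S v) Δ → Cov S w [ η ∶ Δ ]

infix 4 _⊑_
-- Accessibility carries data: there may be several node maps between two worlds, and each places
-- the nodes differently. Edges keep their index literally, while items only need to stay covered.
record _⊑_ (S S' : World) : Set where
  field
    to      : Node S → Node S'
    to-edge : ∀ {w η v} → Edge (shape S) w η v → Edge (shape S') (to w) η (to v)
    to-cov  : ∀ w {x} → x ∈ cont S w → Cov S' (to w) x

open _⊑_

module _ {S S' : World} (r : S ⊑ S') where
  mutual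
    cov-mono : ∀ {w x} → Cov S w x → Cov S' (to r w) x
    cov-mono (here m)      = to-cov r _ m
    cov-mono (∧-cov c d)   = ∧-cov (cov-mono c) (cov-mono d)
    cov-mono (∨-cov₁ c)    = ∨-cov₁ (cov-mono c)
    cov-mono (∨-cov₂ c)    = ∨-cov₂ (cov-mono c)
    cov-mono (⇒-cov c)     = ⇒-cov (cov-mono c)
    cov-mono (◇-cov e c)   = ◇-cov (to-edge r e) (cov-mono c)
    cov-mono ([]-cov e cs) = []-cov (to-edge r e) (covs-mono cs)

    covs-mono : ∀ {w Δ} → All (Cov S w) Δ → All (Cov S' (to r w)) Δ
    covs-mono []       = []
    covs-mono (c ∷ cs) = cov-mono c ∷ covs-mono cs

⊑-refl : ∀ {S} → S ⊑ S
⊑-refl = record { to = id ; to-edge = id ; to-cov = λ _ → here }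

⊑-trans : ∀ {S S' S''} → S ⊑ S' → S' ⊑ S'' → S ⊑ S''
⊑-trans r r' = record
  { to = to r' ∘ to r ; to-edge = to-edge r' ∘ to-edge r ; to-cov = λ w m → cov-mono r' (to-cov r w m) }

∈-set : ∀ S w {Θ x} → x ∈ Θ → x ∈ cont (set S w Θ) w
∈-set S w {x = x} = subst (x ∈_) (sym (updateAt-updates w (cont S)))

∈-set-away : ∀ S w {Θ x u} → u ≢ w → x ∈ cont S u → x ∈ cont (set S w Θ) u
∈-set-away S w {x = x} {u} u≢w = subst (x ∈_) (sym (updateAt-minimal u w (cont S) u≢w))

⊑-set : ∀ {S w Θ} → (∀ {x} → x ∈ cont S w → Cov (set S w Θ) w x) → S ⊑ set S w Θ
⊑-set {S} {w} {Θ} c = record { to = id ; to-edge = id ; to-cov = cov }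
  where
  cov : ∀ u {x} → x ∈ cont S u → Cov (set S w Θ) u x
  cov u m with u ≟ w
  ... | yes refl = c m
  ... | no u≢w   = here (∈-set-away S w u≢w m)

⊑-push : ∀ {S w Θ} → S ⊑ push S w Θ
⊑-push {S} {w} {Θ} = ⊑-set λ m → here (∈-set S w (∈-++⁺ʳ Θ m))

⊑-extend : ∀ {S w η Δ} → S ⊑ extend S w η Δ
⊑-extend = record { to = suc ; to-edge = old ; to-cov = λ _ → here }

⊑-fork : ∀ {S w Θ η Δ} → (∀ {x} → x ∈ cont S w → Cov (extend (set S w Θ) w η Δ) (suc w) x) →
         S ⊑ extend (set S w Θ) w η Δ
⊑-fork {S} {w} {Θ} {η} {Δ} c = record { to = suc ; to-edge = old ; to-cov = cov }
  where
  cov : ∀ u {x} → x ∈ cont S u → Cov (extend (set S w Θ) w η Δ) (suc u) x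
  cov u m with u ≟ w
  ... | yes refl = c m
  ... | no u≢w   = here (∈-set-away S w u≢w m)

-- Flattened worlds seen as fillings of a context.

remove : ∀ {z} → z ∈ Γ → Σ[ Δ ∈ Seq ] (∀ {x} → x ∈ Γ → x ≡ z ⊎ x ∈ Δ) × Γ ∼ (z ∷ Δ)
remove {Γ = _ ∷ Γ} (here refl) = Γ , (λ { (here e) → inj₁ e ; (there m) → inj₂ m }) , ∼-refl _
remove {Γ = y ∷ _} (there m) = let (Δ , f , e) = remove m in
  y ∷ Δ , (λ { (here e) → inj₂ (here e) ; (there m) → map₂ there (f m) }) , trans (cons (∼ᵢ-refl y) e) swap

eraseOut-split : ∀ A Θ Δ → (A ++ eraseOut (Θ ++ Δ)) ∼ ((A ++ eraseOut Δ) ++ eraseOut Θ)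
eraseOut-split A Θ Δ =
  trans (∼-++ˡ A (trans (≡⇒∼ (eraseOut-++ Θ Δ)) (↭⇒∼ (++-comm (eraseOut Θ) (eraseOut Δ)))))
        (≡⇒∼ (sym (++-assoc A _ _)))

-- Everything a left rule with principal item `z` at `w` needs while the goal is at `v`: `whole`
-- gives the conclusion, `replaced` and `forked` the premisses in which `z` gives way to other items
-- or to a new child, and `refocused` the premiss that keeps `z` and moves the goal to `w`. All use
-- the same `ctx`.
record View (S : World) (w : Node S) (z : Item) (v : Node S) (χ : Fm) : Set where
  field
    rest      : Seq
    ctx       : Ctx
    covers    : ∀ {x} → x ∈ cont S w → x ≡ z ⊎ x ∈ rest
    whole     : flatten (shape S) (deco S v [ ◦ χ ]) ∼ (ctx ⟪ eraseOut [ z ] ⟫)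
    replaced  : ∀ Θ → flatten (shape S) (deco (set S w (Θ ++ rest)) v [ ◦ χ ]) ∼ (ctx ⟪ eraseOut Θ ⟫)
    forked    : ∀ η Δ → flatten (grow (shape S) w η) (deco (extend (set S w rest) w η Δ) (suc v) [ ◦ χ ])
                        ∼ (ctx ⟪ [ [ η ∶ eraseOut Δ ] ] ⟫)
    refocused : ∀ Ξ → flatten (shape S) (deco S w Ξ) ∼ (ctx ↓ ⟪ eraseOut [ z ] ++ Ξ ⟫)

  ⊑-replace : ∀ Θ → Cov (set S w (Θ ++ rest)) w z → S ⊑ set S w (Θ ++ rest)
  ⊑-replace Θ c = ⊑-set cov
    where
    cov : ∀ {x} → x ∈ cont S w → Cov (set S w (Θ ++ rest)) w x
    cov m with covers m
    ... | inj₁ refl = c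
    ... | inj₂ m'   = here (∈-set S w (∈-++⁺ʳ Θ m'))

  ⊑-branch : ∀ η Δ → Cov (extend (set S w rest) w η Δ) (suc w) z → S ⊑ extend (set S w rest) w η Δ
  ⊑-branch η Δ c = ⊑-fork cov
    where
    cov : ∀ {x} → x ∈ cont S w → Cov (extend (set S w rest) w η Δ) (suc w) x
    cov m with covers m
    ... | inj₁ refl = c
    ... | inj₂ m'   = here (∈-set S w m')

deco-set-away : ∀ S w Θ v Ξ u → u ≢ w → deco (set S w Θ) v Ξ u ∼ deco S v Ξ u
deco-set-away S w Θ v Ξ u u≢w = ≡⇒∼ (cong (λ Δ → at v Ξ u ++ eraseOut Δ) (updateAt-minimal u w (cont S) u≢w))

view : ∀ {S w z} → z ∈ cont S w → ∀ v χ → View S w z v χ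
view {S} {w} {z} m v χ with remove m | focus (shape S) (deco S v [ ◦ χ ]) w
... | rest , covers , perm | G , F , F↓ = record
  { rest      = rest
  ; ctx       = G ⊙ ((A ++ eraseOut rest) ,, hole)
  ; covers    = covers
  ; whole     = plug (refocus F _ λ _ _ → ∼-refl _)
                  (trans (∼-++ˡ A (eraseOut-∼ perm)) (eraseOut-split A [ z ] rest))
  ; replaced  = λ Θ → plug (refocus F _ (deco-set-away S w (Θ ++ rest) v [ ◦ χ ]))
                  (trans (≡⇒∼ (cong (λ Δ → A ++ eraseOut Δ) (updateAt-updates w (cont S)))) (eraseOut-split A Θ rest))
  ; forked    = λ η Δ → plug
                  (refocus F _ λ u u≢w → trans (≡⇒∼ (updateAt-minimal u w _ u≢w)) (deco-set-away S w rest v [ ◦ χ ] u u≢w))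
                  (trans (≡⇒∼ (updateAt-updates w _))
                    (trans (cons (∼ᵢ-refl _) (≡⇒∼ (cong (λ Δ → A ++ eraseOut Δ) (updateAt-updates w (cont S)))))
                      (↭⇒∼ (++-comm [ _ ] (A ++ eraseOut rest)))))
  ; refocused = λ Ξ → trans (refocus F↓ _ (off Ξ))
                  (trans (⟪⟫-cong (G ↓) (at-w Ξ))
                    (≡⇒∼ (≡-trans (sym (⊙-⟪⟫ (G ↓) _ _)) (cong (_⟪ _ ⟫) (sym (⊙-↓ G _))))))
  }
  where
  -- The goal if `v` is `w`, and empty otherwise. As a part of `ctx` it disappears in `ctx ↓`.
  A : Seq
  A = at v [ ◦ χ ] w
  plug : ∀ {Γ Δ Θ} → Γ ∼ (G ⟪ Δ ⟫) → Δ ∼ ((A ++ eraseOut rest) ++ Θ) → Γ ∼ (G ⊙ ((A ++ eraseOut rest) ,, hole) ⟪ Θ ⟫)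
  plug e f = trans e (trans (⟪⟫-cong G f) (≡⇒∼ (sym (⊙-⟪⟫ G _ _))))
  eraseOut-deco : ∀ u Δ → eraseOut (at v [ ◦ χ ] u ++ eraseOut Δ) ≡ eraseOut Δ
  eraseOut-deco u Δ = ≡-trans (eraseOut-++ (at v [ ◦ χ ] u) _) (cong₂ _++_ (eraseOut-at v χ u) (eraseOut-idem Δ))
  off : ∀ Ξ u → u ≢ w → deco S w Ξ u ∼ eraseOut (deco S v [ ◦ χ ] u)
  off Ξ u u≢w = ≡⇒∼ (≡-trans (cong (_++ eraseOut (cont S u)) (at-away w Ξ u≢w)) (sym (eraseOut-deco u (cont S u))))
  at-w : ∀ Ξ → deco S w Ξ w ∼ (eraseOut (A ++ eraseOut rest) ++ eraseOut [ z ] ++ Ξ)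
  at-w Ξ = trans (≡⇒∼ (cong (_++ eraseOut (cont S w)) (at-here w Ξ)))
    (trans (↭⇒∼ (++-comm Ξ _))
      (trans (∼-++ʳ Ξ (trans (eraseOut-∼ perm) (eraseOut-split [] [ z ] rest)))
        (≡⇒∼ (≡-trans (++-assoc (eraseOut rest) _ Ξ) (cong (_++ eraseOut [ z ] ++ Ξ) (sym (eraseOut-deco w rest)))))))

-- The counterpart of `View` for right rules, where the principal formula is the goal and the hole
-- lies at its node.
record GoalView (S : World) (v : Node S) : Set where
  field
    ctx    : Ctx
    whole  : ∀ Ξ → flatten (shape S) (deco S v Ξ) ∼ (ctx ⟪ Ξ ⟫)
    pushed : ∀ Θ Ξ → flatten (shape S) (deco (push S v Θ) v Ξ) ∼ (ctx ⟪ eraseOut Θ ++ Ξ ⟫)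
    grown  : ∀ η Ξ → flatten (grow (shape S) v η) (deco (extend S v η []) zero Ξ) ∼ (ctx ⟪ [ [ η ∶ Ξ ] ] ⟫)

goalView : ∀ S v → GoalView S v
goalView S v with focus (shape S) (eraseOut ∘ cont S) v
... | G , F , _ = record
  { ctx    = G ⊙ (B ,, hole)
  ; whole  = λ Ξ → plug (refocus F _ (off Ξ)) (trans (≡⇒∼ (cong (_++ B) (at-here v Ξ))) (↭⇒∼ (++-comm Ξ B)))
  ; pushed = λ Θ Ξ → plug
      (refocus F _ λ u u≢v → trans (deco-set-away S v _ v Ξ u u≢v) (off Ξ u u≢v))
      (trans (≡⇒∼ (cong₂ (λ A Δ → A ++ eraseOut Δ) (at-here v Ξ) (updateAt-updates v (cont S))))
        (trans (eraseOut-split Ξ Θ (cont S v))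
          (trans (∼-++ʳ _ (↭⇒∼ (++-comm Ξ B))) (trans (≡⇒∼ (++-assoc B Ξ _)) (∼-++ˡ B (↭⇒∼ (++-comm Ξ _)))))))
  ; grown  = λ η Ξ → plug
      (refocus F _ λ u u≢v → ≡⇒∼ (updateAt-minimal u v _ u≢v))
      (trans (≡⇒∼ (updateAt-updates v _))
        (trans (cons ([]-cong (≡⇒∼ (++-identityʳ Ξ))) (∼-refl _)) (↭⇒∼ (++-comm [ _ ] B))))
  }
  where
  B : Seq
  B = eraseOut (cont S v)
  plug : ∀ {Γ Δ Θ} → Γ ∼ (G ⟪ Δ ⟫) → Δ ∼ (B ++ Θ) → Γ ∼ (G ⊙ (B ,, hole) ⟪ Θ ⟫)
  plug e f = trans e (trans (⟪⟫-cong G f) (≡⇒∼ (sym (⊙-⟪⟫ G _ _))))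
  off : ∀ Ξ u → u ≢ v → deco S v Ξ u ∼ eraseOut (cont S u)
  off Ξ u u≢v = ≡⇒∼ (cong (_++ eraseOut (cont S u)) (at-away v Ξ u≢v))

open View
open GoalView using (grown; pushed)

-- The cut-free rules as operations on worlds.

-- Atoms are never decomposed, so a covered atom is present; the same holds for `⊥'` below.
init-axiom : ∀ {S w p} → Cov S w (• atom p) → S ⊢ w ∶ atom p
init-axiom {S} {w} {p} (here m) = let V = view {S} {w} m w (atom p) in
  derive (exch (∼-sym (refocused V [ ◦ atom p ])) (init (ctx V ↓) p))

⊥-left : ∀ {S w v χ} → Cov S w (• ⊥') → S ⊢ v ∶ χ
⊥-left {S} {w} {v} {χ} (here m) = let V = view {S} {w} m v χ in derive (exch (∼-sym (whole V)) (⊥• (ctx V)))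

-- If the formula was decomposed earlier, the continuation runs in the same world and no rule is
-- applied. Otherwise the rule is applied, and its premiss is the continuation run in the world
-- where the parts replace the formula. The other left rules follow this pattern.
∧-left : ∀ {S w v φ ψ χ} → Cov S w (• (φ ∧' ψ)) →
         (∀ {S'} (r : S ⊑ S') → Cov S' (to r w) (• φ) → Cov S' (to r w) (• ψ) → S' ⊢ to r v ∶ χ) → S ⊢ v ∶ χ
∧-left (∧-cov c d) k = k ⊑-refl c d
∧-left {S} {w} {v} {φ} {ψ} {χ} (here m) k =
  derive (exch (∼-sym (whole V)) (∧• (ctx V) φ ψ (exch (replaced V _) (derivation (k (⊑-replace V Θ (∧-cov c d)) c d)))))
  where
  V = view m v χ
  Θ : Seq
  Θ = • φ ∷ • ψ ∷ []
  c : Cov (set S w (Θ ++ rest V)) w (• φ)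
  c = here (∈-set S w (here refl))
  d : Cov (set S w (Θ ++ rest V)) w (• ψ)
  d = here (∈-set S w (there (here refl)))

∨-left : ∀ {S w v φ ψ χ} → Cov S w (• (φ ∨' ψ)) →
         (∀ {S'} (r : S ⊑ S') → Cov S' (to r w) (• φ) ⊎ Cov S' (to r w) (• ψ) → S' ⊢ to r v ∶ χ) → S ⊢ v ∶ χ
∨-left (∨-cov₁ c) k = k ⊑-refl (inj₁ c)
∨-left (∨-cov₂ c) k = k ⊑-refl (inj₂ c)
∨-left {S} {w} {v} {φ} {ψ} {χ} (here m) k =
  derive (exch (∼-sym (whole V)) (∨• (ctx V) φ ψ
    (exch (replaced V _) (derivation (k (⊑-replace V _ (∨-cov₁ (c φ))) (inj₁ (c φ)))))
    (exch (replaced V _) (derivation (k (⊑-replace V _ (∨-cov₂ (c ψ))) (inj₂ (c ψ)))))))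
  where
  V = view m v χ
  c : ∀ ξ → Cov (set S w ([ • ξ ] ++ rest V)) w (• ξ)
  c ξ = here (∈-set S w (here refl))

⇒-left : ∀ {S w v φ ψ χ} → Cov S w (• (φ ⇒ ψ)) → S ⊢ w ∶ φ →
         (∀ {S'} (r : S ⊑ S') → Cov S' (to r w) (• ψ) → S' ⊢ to r v ∶ χ) → S ⊢ v ∶ χ
⇒-left (⇒-cov c) _ k = k ⊑-refl c
⇒-left {S} {w} {v} {φ} {ψ} {χ} (here m) D k =
  derive (exch (∼-sym (whole V)) (⇒• (ctx V) φ ψ
    (exch (refocused V _) (derivation D))
    (exch (replaced V _) (derivation (k (⊑-replace V _ (⇒-cov c)) c)))))
  where
  V = view m v χ
  c : Cov (set S w ([ • ψ ] ++ rest V)) w (• ψ)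
  c = here (∈-set S w (here refl))

◇-left : ∀ {S w v φ ψ χ} → Cov S w (• (φ ◇→ ψ)) →
         (∀ {S'} (r : S ⊑ S') u → Edge (shape S') (to r w) φ u → Cov S' u (• ψ) → S' ⊢ to r v ∶ χ) → S ⊢ v ∶ χ
◇-left (◇-cov e c) k = k ⊑-refl _ e c
◇-left {S} {w} {v} {φ} {ψ} {χ} (here m) k =
  derive (exch (∼-sym (whole V)) (◇• (ctx V) φ ψ
    (exch (forked V φ [ • ψ ]) (derivation (k (⊑-branch V φ [ • ψ ] (◇-cov new c)) zero new c)))))
  where
  V = view m v χ
  c : Cov (extend (set S w (rest V)) w φ [ • ψ ]) zero (• ψ)
  c = here (here refl)

-- A component stored in the content and a child node with that content flatten to equivalent
-- sequents, so exchange alone suffices.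
component-left : ∀ {S w v η Δ χ} → Cov S w [ η ∶ Δ ] →
  (∀ {S'} (r : S ⊑ S') u → Edge (shape S') (to r w) η u → All (Cov S' u) Δ → S' ⊢ to r v ∶ χ) → S ⊢ v ∶ χ
component-left ([]-cov e cs) k = k ⊑-refl _ e cs
component-left {S} {w} {v} {η} {Δ} {χ} (here m) k =
  derive (exch (trans (forked V η Δ) (∼-sym (whole V))) (derivation (k (⊑-branch V η Δ ([]-cov new cs)) zero new cs)))
  where
  V = view m v χ
  cs : All (Cov (extend (set S w (rest V)) w η Δ) zero) Δ
  cs = All.tabulate here

-- `□•` keeps its principal formula, hence `Cov` has no decomposition clause for it and a covered
-- `□→` formula is literally present.
□-left : ∀ {S w u v φ ψ η χ} → Cov S w (• (φ □→ ψ)) → Edge (shape S) w η u →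
         ⊢[ cutFree ] (• φ) ∷ (◦ η) ∷ [] → ⊢[ cutFree ] (• η) ∷ (◦ φ) ∷ [] →
         (∀ {S'} (r : S ⊑ S') → Cov S' (to r u) (• ψ) → S' ⊢ to r v ∶ χ) → S ⊢ v ∶ χ
□-left {S} {w} {u} {v} {φ} {ψ} {η} {χ} (here m) e D E k
  with remove m | focus-edge (deco S v [ ◦ χ ]) e
... | rest , _ , perm | G , Δ , F =
  derive (exch (∼-sym before) (□• (G ⊙ (A ,, hole)) φ ψ η (deco S v [ ◦ χ ] u ++ Δ) D E (exch after (derivation D'))))
  where
  S' = push S u [ • ψ ]
  A = at v [ ◦ χ ] w ++ eraseOut rest
  D' : S' ⊢ v ∶ χ
  D' = k ⊑-push (here (∈-set S u (here refl)))
  at-w : deco S v [ ◦ χ ] w ∼ (A ++ [ • (φ □→ ψ) ])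
  at-w = trans (∼-++ˡ (at v [ ◦ χ ] w) (eraseOut-∼ perm)) (eraseOut-split (at v [ ◦ χ ] w) [ • (φ □→ ψ) ] rest)
  at-u : deco S' v [ ◦ χ ] u ∼ ((• ψ) ∷ deco S v [ ◦ χ ] u)
  at-u = trans (≡⇒∼ (cong (λ Δ → at v [ ◦ χ ] u ++ eraseOut Δ) (updateAt-updates u (cont S))))
           (↭⇒∼ (shift (• ψ) (at v [ ◦ χ ] u) (eraseOut (cont S u))))
  plug : ∀ {Γ Θ Θ'} → Γ ∼ (G ⟪ Θ ++ Θ' ⟫) → Θ ∼ (A ++ [ • (φ □→ ψ) ]) →
         Γ ∼ (G ⊙ (A ,, hole) ⟪ • (φ □→ ψ) ∷ Θ' ⟫)
  plug e f = trans e (trans (⟪⟫-cong G (trans (∼-++ʳ _ f) (≡⇒∼ (++-assoc A _ _)))) (≡⇒∼ (sym (⊙-⟪⟫ G _ _))))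
  before = plug (F (deco S v [ ◦ χ ]) λ _ _ _ → ∼-refl _) at-w
  after : flatten (shape S) (deco S' v [ ◦ χ ]) ∼
          (G ⊙ (A ,, hole) ⟪ • (φ □→ ψ) ∷ [ η ∶ • ψ ∷ deco S v [ ◦ χ ] u ++ Δ ] ∷ [] ⟫)
  -- The ends of `e` differ, so pushing at `u` leaves the content at `w` unchanged.
  after = trans (plug (F (deco S' v [ ◦ χ ]) λ i _ i≢u → deco-set-away S u _ v [ ◦ χ ] i i≢u)
                  (trans (deco-set-away S u _ v [ ◦ χ ] w (edge-irrefl e)) at-w))
            (⟪⟫-cong (G ⊙ (A ,, hole)) (cons •-cong (cons ([]-cong (∼-++ʳ Δ at-u)) nil)))

∧-right : ∀ {S v φ ψ} → S ⊢ v ∶ φ → S ⊢ v ∶ ψ → S ⊢ v ∶ φ ∧' ψ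
∧-right {S} {v} {φ} {ψ} (derive D) (derive E) =
  derive (exch (∼-sym (GoalView.whole V _)) (∧◦ (GoalView.ctx V) φ ψ (exch (GoalView.whole V _) D) (exch (GoalView.whole V _) E)))
  where V = goalView S v

∨-right₁ : ∀ {S v φ ψ} → S ⊢ v ∶ φ → S ⊢ v ∶ φ ∨' ψ
∨-right₁ {S} {v} {φ} {ψ} (derive D) =
  derive (exch (∼-sym (GoalView.whole V _)) (∨◦₁ (GoalView.ctx V) φ ψ (exch (GoalView.whole V _) D)))
  where V = goalView S v

∨-right₂ : ∀ {S v φ ψ} → S ⊢ v ∶ ψ → S ⊢ v ∶ φ ∨' ψ
∨-right₂ {S} {v} {φ} {ψ} (derive D) =
  derive (exch (∼-sym (GoalView.whole V _)) (∨◦₂ (GoalView.ctx V) φ ψ (exch (GoalView.whole V _) D)))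
  where V = goalView S v

⇒-right : ∀ {S v φ ψ} → push S v [ • φ ] ⊢ v ∶ ψ → S ⊢ v ∶ φ ⇒ ψ
⇒-right {S} {v} {φ} {ψ} (derive D) =
  derive (exch (∼-sym (GoalView.whole V _)) (⇒◦ (GoalView.ctx V) φ ψ (exch (pushed V [ • φ ] _) D)))
  where V = goalView S v

□-right : ∀ {S v φ ψ} → extend S v φ [] ⊢ zero ∶ ψ → S ⊢ v ∶ φ □→ ψ
□-right {S} {v} {φ} {ψ} (derive D) =
  derive (exch (∼-sym (GoalView.whole V _)) (□◦ (GoalView.ctx V) φ ψ (exch (grown V φ _) D)))
  where V = goalView S v

-- Read upwards, the goal crosses the edge: it sits at `w` in the conclusion and at `v` in the
-- premiss, so `focus-edge` is applied to both decorations.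
◇-right : ∀ {S w v φ ψ η} → Edge (shape S) w η v →
          ⊢[ cutFree ] (• φ) ∷ (◦ η) ∷ [] → ⊢[ cutFree ] (• η) ∷ (◦ φ) ∷ [] →
          S ⊢ v ∶ ψ → S ⊢ w ∶ φ ◇→ ψ
◇-right {S} {w} {v} {φ} {ψ} {η} e D E (derive D') with focus-edge (eraseOut ∘ cont S) e
... | G , Δ , F = derive (exch (∼-sym before) (◇◦ (G ⊙ (B ,, hole)) φ ψ η (C ++ Δ) D E (exch after D')))
  where
  w≢v = edge-irrefl e
  B = eraseOut (cont S w)
  C = eraseOut (cont S v)
  before : flatten (shape S) (deco S w [ ◦ (φ ◇→ ψ) ]) ∼ (G ⊙ (B ,, hole) ⟪ ◦ (φ ◇→ ψ) ∷ [ η ∶ C ++ Δ ] ∷ [] ⟫)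
  before = trans (F _ λ u u≢w _ → ≡⇒∼ (cong (_++ eraseOut (cont S u)) (at-away w _ u≢w)))
    (trans (⟪⟫-cong G (trans
        (≡⇒∼ (cong₂ (λ X Y → (X ++ B) ++ [ [ η ∶ (Y ++ C) ++ Δ ] ]) (at-here w _) (at-away w _ (≢-sym w≢v))))
        (↭⇒∼ (↭-sym (shift (◦ (φ ◇→ ψ)) B _)))))
      (≡⇒∼ (sym (⊙-⟪⟫ G _ _))))
  after : flatten (shape S) (deco S v [ ◦ ψ ]) ∼ (G ⊙ (B ,, hole) ⟪ [ [ η ∶ ◦ ψ ∷ C ++ Δ ] ] ⟫)
  after = trans (F _ λ u _ u≢v → ≡⇒∼ (cong (_++ eraseOut (cont S u)) (at-away v _ u≢v)))
    (trans (⟪⟫-cong G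
        (≡⇒∼ (cong₂ (λ X Y → (X ++ B) ++ [ [ η ∶ (Y ++ C) ++ Δ ] ]) (at-away v _ w≢v) (at-here v _))))
      (≡⇒∼ (sym (⊙-⟪⟫ G _ _))))

-- Interpretation of formulas.

Sem : Set₁
Sem = (S : World) → Node S → Set

infix 4 _∝_
_∝_ : Sem → Fm → Set
X ∝ η = (∀ {S w} → Cov S w (• η) → X S w) × (∀ {S w} → X S w → S ⊢ w ∶ η)

R : Sem → (S : World) → Node S → Node S → Set
R X S w v = Σ[ η ∈ Fm ] Edge (shape S) w η v × X ∝ η

-- Continuation monad over all possible output formulas, needed for ⊥, ∨ and ◇→.
T : (S : World) → ((S' : World) → (Node S → Node S') → Set) → Set
T S P = ∀ {S'} (r : S ⊑ S') v χ →
        (∀ {S''} (r' : S' ⊑ S'') → P S'' (to r' ∘ to r) → S'' ⊢ to r' v ∶ χ) → S' ⊢ v ∶ χ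

-- Derivability of an atom is demanded in all later worlds, because along `⊑` formulas of the
-- content may have been replaced by their parts. Monotonicity is thus built into every clause
-- except the one for `∧'`, which inherits it.
⟦_⟧ : Fm → Sem
⟦ atom p ⟧ S w = ∀ {S'} (r : S ⊑ S') → S' ⊢ to r w ∶ atom p
⟦ ⊥' ⟧     S w = T S λ _ _ → ⊥
⟦ φ ∧' ψ ⟧ S w = ⟦ φ ⟧ S w × ⟦ ψ ⟧ S w
⟦ φ ∨' ψ ⟧ S w = T S λ S' f → ⟦ φ ⟧ S' (f w) ⊎ ⟦ ψ ⟧ S' (f w)
⟦ φ ⇒ ψ ⟧  S w = ∀ {S'} (r : S ⊑ S') → ⟦ φ ⟧ S' (to r w) → ⟦ ψ ⟧ S' (to r w)
⟦ φ □→ ψ ⟧ S w = ∀ {S'} (r : S ⊑ S') v → R ⟦ φ ⟧ S' (to r w) v → ⟦ ψ ⟧ S' v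
⟦ φ ◇→ ψ ⟧ S w = T S λ S' f → Σ[ v ∈ Node S' ] R ⟦ φ ⟧ S' (f w) v × ⟦ ψ ⟧ S' v

R-mono : ∀ X {S S' w v} (r : S ⊑ S') → R X S w v → R X S' (to r w) (to r v)
R-mono X r (η , e , α) = η , to-edge r e , α

mono : ∀ φ {S S' w} (r : S ⊑ S') → ⟦ φ ⟧ S w → ⟦ φ ⟧ S' (to r w)
mono (atom p) r a r'         = a (⊑-trans r r')
mono ⊥'       r a r'         = a (⊑-trans r r')
mono (φ ∧' ψ) r (a , b)      = mono φ r a , mono ψ r b
mono (φ ∨' ψ) r a r'         = a (⊑-trans r r')
mono (φ ⇒ ψ)  r a r'         = a (⊑-trans r r')
mono (φ □→ ψ) r a r'         = a (⊑-trans r r')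
mono (φ ◇→ ψ) r a r'         = a (⊑-trans r r')

T-return : ∀ {S} (P : (S' : World) → (Node S → Node S') → Set) →
           (∀ {S'} (r : S ⊑ S') → P S' (to r)) → T S P
T-return P p r v χ k = k ⊑-refl (p r)

T-join : ∀ {S} (P : (S' : World) → (Node S → Node S') → Set) →
         T S (λ S' f → T S' λ S'' g → P S'' (g ∘ f)) → T S P
T-join P t r v χ k = t r v χ λ r' t' → t' ⊑-refl (to r' v) χ λ r'' p → k (⊑-trans r' r'') p

-- Every interpretation is an algebra for `T`. For an atom the computation is run with that atom as
-- its goal; the clauses for `⊥'`, `∨'` and `◇→` are of the form `T` and use its multiplication; the
-- others reduce to their components or to the succedent.
stable : ∀ φ {S w} → T S (λ S' f → ⟦ φ ⟧ S' (f w)) → ⟦ φ ⟧ S w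
stable (atom p) {w = w} t r = t r (to r w) (atom p) λ r' a → a ⊑-refl
stable ⊥'       t = T-join (λ _ _ → ⊥) t
stable (φ ∧' ψ) t = stable φ (λ r v χ k → t r v χ λ r' a → k r' (proj₁ a)) ,
                    stable ψ (λ r v χ k → t r v χ λ r' a → k r' (proj₂ a))
stable (φ ∨' ψ) {w = w} t = T-join (λ S' f → ⟦ φ ⟧ S' (f w) ⊎ ⟦ ψ ⟧ S' (f w)) t
stable (φ ⇒ ψ)  t r a = stable ψ λ r' v χ k → t (⊑-trans r r') v χ λ r'' f →
                          k r'' (f ⊑-refl (mono φ (⊑-trans r' r'') a))
stable (φ □→ ψ) t r u ρ = stable ψ λ r' v χ k → t (⊑-trans r r') v χ λ r'' f →
                          k r'' (f ⊑-refl _ (R-mono ⟦ φ ⟧ (⊑-trans r' r'') ρ))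
stable (φ ◇→ ψ) {w = w} t = T-join (λ S' f → Σ[ v ∈ Node S' ] R ⟦ φ ⟧ S' (f w) v × ⟦ ψ ⟧ S' v) t

-- Reflection of covered inputs and reification into derivations.

-- In the one-node world containing `• φ`, reflection gives `X` and reification gives `◦ η`. The two
-- indices are linked through `X`, which is how the index premisses of `□•` and `◇◦` are obtained
-- without cut.
∝-entails : ∀ X φ η → X ∝ φ → X ∝ η → ⊢[ cutFree ] (• φ) ∷ (◦ η) ∷ []
∝-entails X φ η (reflectφ , _) (_ , reifyη) =
  exch swap (derivation (reifyη {world leaf (const [ • φ ])} {zero} (reflectφ (here (here refl)))))

mutual
  -- Where a left rule needs a goal, the clause itself supplies one if it has the form `T`;
  -- otherwise `stable` does, at a component or at the succedent.
  reflect : ∀ φ {S w} → Cov S w (• φ) → ⟦ φ ⟧ S w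
  reflect (atom p) c r = init-axiom (cov-mono r c)
  reflect ⊥' c r v χ k = ⊥-left (cov-mono r c)
  reflect (φ ∧' ψ) c =
    stable φ (λ r v χ k → ∧-left (cov-mono r c) λ r' d e → k r' (reflect φ d)) ,
    stable ψ (λ r v χ k → ∧-left (cov-mono r c) λ r' d e → k r' (reflect ψ e))
  reflect (φ ∨' ψ) c r v χ k = ∨-left (cov-mono r c) λ
    { r' (inj₁ d) → k r' (inj₁ (reflect φ d)) ; r' (inj₂ d) → k r' (inj₂ (reflect ψ d)) }
  reflect (φ ⇒ ψ) c r a = stable ψ λ r' v χ k →
    ⇒-left (cov-mono (⊑-trans r r') c) (reify φ (mono φ r' a)) λ r'' d → k r'' (reflect ψ d)
  -- The edge index `η` may differ from `φ`. Both stand in `∝` to `⟦ φ ⟧`, which yields the two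
  -- index premisses.
  reflect (φ □→ ψ) c r u (η , e , α) = stable ψ λ r' v χ k →
    □-left (cov-mono (⊑-trans r r') c) (to-edge r' e)
      (∝-entails ⟦ φ ⟧ φ η (adequate φ) α) (∝-entails ⟦ φ ⟧ η φ α (adequate φ)) λ r'' d → k r'' (reflect ψ d)
  reflect (φ ◇→ ψ) c r v χ k = ◇-left (cov-mono r c) λ r' u e d → k r' (u , (φ , e , adequate φ) , reflect ψ d)

  -- A clause of the form `T` is run with the formula itself as goal, so that its continuation can
  -- end with the right rule.
  reify : ∀ φ {S w} → ⟦ φ ⟧ S w → S ⊢ w ∶ φ
  reify (atom p) a = a ⊑-refl
  reify ⊥' {w = w} a = a ⊑-refl w ⊥' λ _ ()
  reify (φ ∧' ψ) (a , b) = ∧-right (reify φ a) (reify ψ b)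
  reify (φ ∨' ψ) {w = w} a = a ⊑-refl w (φ ∨' ψ) λ
    { _ (inj₁ b) → ∨-right₁ (reify φ b) ; _ (inj₂ b) → ∨-right₂ (reify ψ b) }
  reify (φ ⇒ ψ) {S} {w} a = ⇒-right (reify ψ (a ⊑-push (reflect φ (here (∈-set S w (here refl))))))
  -- The fresh child has index `φ` itself, so `adequate φ` makes it a successor along `⟦ φ ⟧`.
  reify (φ □→ ψ) a = □-right (reify ψ (a ⊑-extend zero (φ , new , adequate φ)))
  reify (φ ◇→ ψ) {w = w} a = a ⊑-refl w (φ ◇→ ψ) λ { _ (u , (η , e , α) , b) →
    ◇-right e (∝-entails ⟦ φ ⟧ φ η (adequate φ) α) (∝-entails ⟦ φ ⟧ η φ α (adequate φ)) (reify ψ b) }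

  adequate : ∀ φ → ⟦ φ ⟧ ∝ φ
  adequate φ = reflect φ , reify φ

-- Counting output formulas.

outs-++ : ∀ Γ Δ → outs (Γ ++ Δ) ≡ outs Γ + outs Δ
outs-++ []              Δ = refl
outs-++ ((• φ) ∷ Γ)     Δ = outs-++ Γ Δ
outs-++ ((◦ φ) ∷ Γ)     Δ = cong suc (outs-++ Γ Δ)
outs-++ ([ η ∶ Θ ] ∷ Γ) Δ = ≡-trans (cong (outs Θ +_) (outs-++ Γ Δ)) (sym (+-assoc (outs Θ) _ _))

outs-∷ : ∀ x Γ → outs (x ∷ Γ) ≡ outs [ x ] + outs Γ
outs-∷ x Γ = outs-++ [ x ] Γ

outs-∼ : Γ ∼ Δ → outs Γ ≡ outs Δ
outs-∼ nil                      = refl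
outs-∼ (cons •-cong e)          = outs-∼ e
outs-∼ (cons ◦-cong e)          = cong suc (outs-∼ e)
outs-∼ (cons ([]-cong e) f)     = cong₂ _+_ (outs-∼ e) (outs-∼ f)
outs-∼ (swap {x} {y} {Γ})       =
  ≡-trans (outs-++ (x ∷ y ∷ []) Γ) (≡-trans (cong (_+ outs Γ) flip) (sym (outs-++ (y ∷ x ∷ []) Γ)))
  where
  flip : outs (x ∷ y ∷ []) ≡ outs (y ∷ x ∷ [])
  flip = ≡-trans (outs-∷ x [ y ]) (≡-trans (+-comm (outs [ x ]) _) (sym (outs-∷ y [ x ])))
outs-∼ (trans e f)              = ≡-trans (outs-∼ e) (outs-∼ f)

outs-eraseOut : ∀ Γ → outs (eraseOut Γ) ≡ 0
outs-eraseOut []              = refl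
outs-eraseOut ((• φ) ∷ Γ)     = outs-eraseOut Γ
outs-eraseOut ((◦ φ) ∷ Γ)     = outs-eraseOut Γ
outs-eraseOut ([ η ∶ Δ ] ∷ Γ) = cong₂ _+_ (outs-eraseOut Δ) (outs-eraseOut Γ)

outsᶜ : Ctx → ℕ
outsᶜ hole       = 0
outsᶜ (Δ ,, G)   = outs Δ + outsᶜ G
outsᶜ [ η ∶∶ G ] = outsᶜ G

outs-⟪⟫ : ∀ G Γ → outs (G ⟪ Γ ⟫) ≡ outsᶜ G + outs Γ
outs-⟪⟫ hole       Γ = refl
outs-⟪⟫ (Δ ,, G)   Γ = ≡-trans (outs-++ Δ _) (≡-trans (cong (outs Δ +_) (outs-⟪⟫ G Γ)) (sym (+-assoc (outs Δ) _ _)))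
outs-⟪⟫ [ η ∶∶ G ] Γ = ≡-trans (+-identityʳ _) (outs-⟪⟫ G Γ)

outsᶜ-↓ : ∀ G → outsᶜ (G ↓) ≡ 0
outsᶜ-↓ hole       = refl
outsᶜ-↓ (Δ ,, G)   = cong₂ _+_ (outs-eraseOut Δ) (outsᶜ-↓ G)
outsᶜ-↓ [ η ∶∶ G ] = outsᶜ-↓ G

nested-refill : ∀ G {Γ Δ} → outs Γ ≡ outs Δ → NestedSeq (G ⟪ Γ ⟫) → NestedSeq (G ⟪ Δ ⟫)
nested-refill G {Γ} {Δ} e i =
  ≡-trans (outs-⟪⟫ G Δ) (≡-trans (cong (outsᶜ G +_) (sym e)) (≡-trans (sym (outs-⟪⟫ G Γ)) i))

nested-↓ : ∀ G {Γ} → NestedSeq Γ → NestedSeq ((G ↓) ⟪ Γ ⟫)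
nested-↓ G {Γ} i = ≡-trans (outs-⟪⟫ (G ↓) Γ) (cong₂ _+_ (outsᶜ-↓ G) i)

-- When the only output sits in the hole, the surroundings are input. This lets `⇒◦` and `□◦`
-- evaluate their premiss towards a new goal.
input-ctx : ∀ G {Γ} → NestedSeq Γ → NestedSeq (G ⟪ Γ ⟫) → outsᶜ G ≡ 0
input-ctx G {Γ} i j = suc-injective (≡-trans (+-comm 1 (outsᶜ G))
  (≡-trans (cong (outsᶜ G +_) (sym i)) (≡-trans (sym (outs-⟪⟫ G Γ)) j)))

-- Environments for sequents and contexts.

-- An output formula is read as a continuation towards the goal χ at v.
Env : Seq → (S : World) → Node S → Node S → Fm → Set
Env []              S w v χ = ⊤
Env ((• φ) ∷ Γ)     S w v χ = ⟦ φ ⟧ S w × Env Γ S w v χ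
Env ((◦ φ) ∷ Γ)     S w v χ = (∀ {S'} (r : S ⊑ S') → ⟦ φ ⟧ S' (to r w) → S' ⊢ to r v ∶ χ) × Env Γ S w v χ
Env ([ η ∶ Δ ] ∷ Γ) S w v χ = (Σ[ u ∈ Node S ] R ⟦ η ⟧ S w u × Env Δ S u v χ) × Env Γ S w v χ

Env-mono : ∀ Γ {S S' w v χ} (r : S ⊑ S') → Env Γ S w v χ → Env Γ S' (to r w) (to r v) χ
Env-mono []              r _                 = tt
Env-mono ((• φ) ∷ Γ)     r (a , γ)           = mono φ r a , Env-mono Γ r γ
Env-mono ((◦ φ) ∷ Γ)     r (k , γ)           = (λ r' → k (⊑-trans r r')) , Env-mono Γ r γ
Env-mono ([ η ∶ Δ ] ∷ Γ) r ((u , ρ , δ) , γ) = (to r u , R-mono ⟦ η ⟧ r ρ , Env-mono Δ r δ) , Env-mono Γ r γ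

Env-∼ : ∀ {Γ Δ S w v χ} → Γ ∼ Δ → Env Γ S w v χ → Env Δ S w v χ
Env-∼ nil                  _                 = tt
Env-∼ (cons •-cong e)      (a , γ)           = a , Env-∼ e γ
Env-∼ (cons ◦-cong e)      (k , γ)           = k , Env-∼ e γ
Env-∼ (cons ([]-cong e) f) ((u , ρ , δ) , γ) = (u , ρ , Env-∼ e δ) , Env-∼ f γ
Env-∼ (trans e f)          γ                 = Env-∼ f (Env-∼ e γ)
Env-∼ (swap {• _}     {• _})     (a , b , γ) = b , a , γ
Env-∼ (swap {• _}     {◦ _})     (a , b , γ) = b , a , γ
Env-∼ (swap {• _}     {[ _ ∶ _ ]}) (a , b , γ) = b , a , γ
Env-∼ (swap {◦ _}     {• _})     (a , b , γ) = b , a , γ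
Env-∼ (swap {◦ _}     {◦ _})     (a , b , γ) = b , a , γ
Env-∼ (swap {◦ _}     {[ _ ∶ _ ]}) (a , b , γ) = b , a , γ
Env-∼ (swap {[ _ ∶ _ ]} {• _})     (a , b , γ) = b , a , γ
Env-∼ (swap {[ _ ∶ _ ]} {◦ _})     (a , b , γ) = b , a , γ
Env-∼ (swap {[ _ ∶ _ ]} {[ _ ∶ _ ]}) (a , b , γ) = b , a , γ

Env-++⁻ : ∀ Γ {Δ S w v χ} → Env (Γ ++ Δ) S w v χ → Env Γ S w v χ × Env Δ S w v χ
Env-++⁻ []              δ = tt , δ
Env-++⁻ ((• _) ∷ Γ)     (a , γ) = let (β , δ) = Env-++⁻ Γ γ in (a , β) , δ
Env-++⁻ ((◦ _) ∷ Γ)     (a , γ) = let (β , δ) = Env-++⁻ Γ γ in (a , β) , δ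
Env-++⁻ ([ _ ∶ _ ] ∷ Γ) (a , γ) = let (β , δ) = Env-++⁻ Γ γ in (a , β) , δ

Env-++⁺ : ∀ Γ {Δ S w v χ} → Env Γ S w v χ → Env Δ S w v χ → Env (Γ ++ Δ) S w v χ
Env-++⁺ []              _       δ = δ
Env-++⁺ ((• _) ∷ Γ)     (a , γ) δ = a , Env-++⁺ Γ γ δ
Env-++⁺ ((◦ _) ∷ Γ)     (a , γ) δ = a , Env-++⁺ Γ γ δ
Env-++⁺ ([ _ ∶ _ ] ∷ Γ) (a , γ) δ = a , Env-++⁺ Γ γ δ

-- The goal is mentioned only in the clause for outputs, so once these are erased it can be
-- exchanged for any other.
Env-eraseOut : ∀ Γ {S w v χ} v' χ' → Env Γ S w v χ → Env (eraseOut Γ) S w v' χ'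
Env-eraseOut []              v' χ' _                 = tt
Env-eraseOut ((• _) ∷ Γ)     v' χ' (a , γ)           = a , Env-eraseOut Γ v' χ' γ
Env-eraseOut ((◦ _) ∷ Γ)     v' χ' (_ , γ)           = Env-eraseOut Γ v' χ' γ
Env-eraseOut ([ _ ∶ Δ ] ∷ Γ) v' χ' ((u , ρ , δ) , γ) = (u , ρ , Env-eraseOut Δ v' χ' δ) , Env-eraseOut Γ v' χ' γ

Env-regoal : ∀ Γ {S w v χ} v' χ' → InputSeq Γ → Env Γ S w v χ → Env Γ S w v' χ'
Env-regoal Γ {S} {w} v' χ' i γ = subst (λ Δ → Env Δ S w v' χ') (eraseOut-input Γ i) (Env-eraseOut Γ v' χ' γ)

-- The index `w` is the node of the root and `u` the node reached by the hole, where a filling is to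
-- be evaluated.
data Envᶜ : Ctx → (S : World) → Node S → Node S → Node S → Fm → Set where
  hole   : ∀ {S w v χ} → Envᶜ hole S w w v χ
  _,,_   : ∀ {Δ G S w u v χ} → Env Δ S w v χ → Envᶜ G S w u v χ → Envᶜ (Δ ,, G) S w u v χ
  inside : ∀ {η G S w w' u v χ} → R ⟦ η ⟧ S w w' → Envᶜ G S w' u v χ → Envᶜ [ η ∶∶ G ] S w u v χ

Envᶜ-mono : ∀ {G S S' w u v χ} (r : S ⊑ S') → Envᶜ G S w u v χ → Envᶜ G S' (to r w) (to r u) (to r v) χ
Envᶜ-mono r hole             = hole
Envᶜ-mono r (_,,_ {Δ} δ g)   = Env-mono Δ r δ ,, Envᶜ-mono r g
Envᶜ-mono r (inside {η} ρ g) = inside (R-mono ⟦ η ⟧ r ρ) (Envᶜ-mono r g)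

Envᶜ-↓ : ∀ {G S w u v χ} v' χ' → Envᶜ G S w u v χ → Envᶜ (G ↓) S w u v' χ'
Envᶜ-↓ v' χ' hole           = hole
Envᶜ-↓ v' χ' (_,,_ {Δ} δ g) = Env-eraseOut Δ v' χ' δ ,, Envᶜ-↓ v' χ' g
Envᶜ-↓ v' χ' (inside ρ g)   = inside ρ (Envᶜ-↓ v' χ' g)

Envᶜ-regoal : ∀ {G S w u v χ} v' χ' → outsᶜ G ≡ 0 → Envᶜ G S w u v χ → Envᶜ G S w u v' χ'
Envᶜ-regoal v' χ' i hole           = hole
Envᶜ-regoal v' χ' i (_,,_ {Δ} δ g) =
  Env-regoal Δ v' χ' (m+n≡0⇒m≡0 (outs Δ) i) δ ,, Envᶜ-regoal v' χ' (m+n≡0⇒n≡0 (outs Δ) i) g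
Envᶜ-regoal v' χ' i (inside ρ g)   = inside ρ (Envᶜ-regoal v' χ' i g)

Env-plug : ∀ {G} Γ {S w u v χ} → Envᶜ G S w u v χ → Env Γ S u v χ → Env (G ⟪ Γ ⟫) S w v χ
Env-plug Γ hole           γ = γ
Env-plug Γ (_,,_ {Δ} δ g) γ = Env-++⁺ Δ δ (Env-plug Γ g γ)
Env-plug Γ (inside ρ g)   γ = (_ , ρ , Env-plug Γ g γ) , tt

Env-split : ∀ G {Γ S w v χ} → Env (G ⟪ Γ ⟫) S w v χ → Σ[ u ∈ Node S ] Envᶜ G S w u v χ × Env Γ S u v χ
Env-split hole       γ = _ , hole , γ
Env-split (Δ ,, G)   γ = let (δ , γ') = Env-++⁻ Δ γ ; (u , g , β) = Env-split G γ' in u , (δ ,, g) , β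
Env-split [ η ∶∶ G ] ((w' , ρ , γ) , _) = let (u , g , β) = Env-split G γ in u , inside ρ g , β

-- Soundness of all rules, including cut.

-- A predicate enters `R` only through `∝`, which respects equivalence. The index premisses of `□•`
-- and `◇◦` supply the two inclusions by way of `entails`.
R-cong : ∀ X Y → (∀ {S w} → X S w → Y S w) → (∀ {S w} → Y S w → X S w) → ∀ {S w v} → R X S w v → R Y S w v
R-cong X Y f g (η , e , reflectη , reifyη) = η , e , f ∘ reflectη , reifyη ∘ g

mutual
  sound : ∀ {c Γ} → NestedSeq Γ → ⊢[ c ] Γ → ∀ {S w v χ} → Env Γ S w v χ → S ⊢ v ∶ χ
  sound i (exch e D) γ = sound (≡-trans (outs-∼ e) i) D (Env-∼ (∼-sym e) γ)
  sound i (init G p) γ = let (u , g , a , k , _) = Env-split G γ in k ⊑-refl a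
  sound i (⊥• G) γ = let (u , g , a , _) = Env-split G γ in a ⊑-refl _ _ λ _ ()
  sound i (∧• G φ ψ D) γ = let (u , g , (a , b) , _) = Env-split G γ in
    sound-in G (• φ ∷ • ψ ∷ []) (nested-refill G refl i) D g (a , b , tt)
  -- The second premiss is evaluated inside the continuation for the first, so that both values are
  -- available to `k`.
  sound i (∧◦ G φ ψ D E) γ = let (u , g , k , _) = Env-split G γ in
    sound-in G [ ◦ φ ] (nested-refill G refl i) D g ((λ r a →
      sound-in G [ ◦ ψ ] (nested-refill G refl i) E (Envᶜ-mono r g) ((λ r' b →
        k (⊑-trans r r') (mono φ r' a , b)) , tt)) , tt)
  sound i (∨• G φ ψ D E) γ = let (u , g , a , _) = Env-split G γ in a ⊑-refl _ _ λ
    { r (inj₁ b) → sound-in G [ • φ ] (nested-refill G refl i) D (Envᶜ-mono r g) (b , tt)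
    ; r (inj₂ b) → sound-in G [ • ψ ] (nested-refill G refl i) E (Envᶜ-mono r g) (b , tt) }
  sound i (∨◦₁ G φ ψ D) γ = let (u , g , k , _) = Env-split G γ in
    sound-in G [ ◦ φ ] (nested-refill G refl i) D g ((λ r a →
      k r (T-return (λ S' f → ⟦ φ ⟧ S' (f (to r u)) ⊎ ⟦ ψ ⟧ S' (f (to r u))) λ r' → inj₁ (mono φ r' a))) , tt)
  sound i (∨◦₂ G φ ψ D) γ = let (u , g , k , _) = Env-split G γ in
    sound-in G [ ◦ ψ ] (nested-refill G refl i) D g ((λ r a →
      k r (T-return (λ S' f → ⟦ φ ⟧ S' (f (to r u)) ⊎ ⟦ ψ ⟧ S' (f (to r u))) λ r' → inj₂ (mono ψ r' a))) , tt)
  -- The first premiss computes a value of `⟦ φ ⟧`: its output is answered by the continuation that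
  -- `stable` provides, and the erased context accepts the new goal.
  sound i (⇒• G φ ψ D E) γ = let (u , g , f , _) = Env-split G γ in
    sound-in G [ • ψ ] (nested-refill G refl i) E g (f ⊑-refl
      (stable φ λ r v χ k → sound-in (G ↓) (• (φ ⇒ ψ) ∷ ◦ φ ∷ []) (nested-↓ G refl) D
        (Envᶜ-↓ v χ (Envᶜ-mono r g)) (mono (φ ⇒ ψ) r f , k , tt)) , tt)
  -- `stable ψ` introduces a fresh goal, to which the environment of the input context is
  -- transferred.
  sound i (⇒◦ G φ ψ D) γ = let (u , g , k , _) = Env-split G γ in
    k ⊑-refl λ r a → stable ψ λ r' v χ k' → sound-in G (• φ ∷ ◦ ψ ∷ []) (nested-refill G refl i) D
      (Envᶜ-regoal v χ (input-ctx G refl i) (Envᶜ-mono (⊑-trans r r') g)) (mono φ r' a , k' , tt)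
  sound i (□• G φ ψ η Δ D E F) {S} γ = let (u , g , f , (u' , ρ , δ) , _) = Env-split G γ in
    sound-in G (• (φ □→ ψ) ∷ [ η ∶ • ψ ∷ Δ ] ∷ []) (nested-refill G refl i) F g
      (f , (u' , ρ , f ⊑-refl u' (R-cong ⟦ η ⟧ ⟦ φ ⟧ (entails E) (entails D) {S} ρ) , δ) , tt)
  sound i (□◦ G φ ψ D) γ = let (u , g , k , _) = Env-split G γ in
    k ⊑-refl λ r u' ρ → stable ψ λ r' v χ k' → sound-in G [ [ φ ∶ [ ◦ ψ ] ] ] (nested-refill G refl i) D
      (Envᶜ-regoal v χ (input-ctx G refl i) (Envᶜ-mono (⊑-trans r r') g))
      ((_ , R-mono ⟦ φ ⟧ r' ρ , k' , tt) , tt)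
  sound i (◇• G φ ψ D) γ = let (u , g , a , _) = Env-split G γ in a ⊑-refl _ _ λ
    { r (u' , ρ , b) → sound-in G [ [ φ ∶ [ • ψ ] ] ] (nested-refill G refl i) D
        (Envᶜ-mono r g) ((u' , ρ , b , tt) , tt) }
  sound i (◇◦ G φ ψ η Δ D E F) {S} γ = let (u , g , k , (u' , ρ , δ) , _) = Env-split G γ in
    sound-in G [ [ η ∶ ◦ ψ ∷ Δ ] ] (nested-refill G refl i) F g ((u' , ρ , (λ r a →
      k r (T-return (λ S' f → Σ[ v ∈ Node S' ] R ⟦ φ ⟧ S' (f (to r u)) v × ⟦ ψ ⟧ S' v) λ r' →
        _ , R-mono ⟦ φ ⟧ (⊑-trans r r') (R-cong ⟦ η ⟧ ⟦ φ ⟧ (entails E) (entails D) {S} ρ) , mono ψ r' a)) , δ) , tt)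
  -- The first premiss is a computation of `⟦ ξ ⟧`; `stable` turns it into a value, which serves as
  -- the input of the second premiss.
  sound i (cut G ξ D E) γ = let (u , g , _) = Env-split G γ in
    sound-in G [ • ξ ] (nested-refill G refl i) E g
      (stable ξ (λ r v χ k → sound-in (G ↓) [ ◦ ξ ] (nested-↓ G refl) D
        (Envᶜ-↓ v χ (Envᶜ-mono r g)) (k , tt)) , tt)

  sound-in : ∀ {c} G Γ → NestedSeq (G ⟪ Γ ⟫) → ⊢[ c ] G ⟪ Γ ⟫ →
             ∀ {S w u v χ} → Envᶜ G S w u v χ → Env Γ S u v χ → S ⊢ v ∶ χ
  sound-in G Γ i D g γ = sound i D (Env-plug Γ g γ)

  -- The output `◦ ψ` is answered by the continuation of `T`, and `stable` extracts the resulting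
  -- value.
  entails : ∀ {c φ ψ} → ⊢[ c ] (• φ) ∷ (◦ ψ) ∷ [] → ∀ {S w} → ⟦ φ ⟧ S w → ⟦ ψ ⟧ S w
  entails {φ = φ} {ψ} D a = stable ψ λ r v χ k → sound refl D (mono φ r a , k , tt)

-- From semantic validity back to cut-free derivations.

-- Stated with a continuation because turning a component into a child node changes the world. What
-- was already obtained is carried along by monotonicity.
reflectSeq : ∀ Γ → InputSeq Γ → ∀ {S w v χ} → All (Cov S w) Γ →
  (∀ {S'} (r : S ⊑ S') → Env Γ S' (to r w) (to r v) χ → S' ⊢ to r v ∶ χ) → S ⊢ v ∶ χ
reflectSeq [] i [] k = k ⊑-refl tt
reflectSeq ((• φ) ∷ Γ) i (c ∷ cs) k = reflectSeq Γ i cs λ r γ → k r (mono φ r (reflect φ c) , γ)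
reflectSeq ([ η ∶ Δ ] ∷ Γ) i (c ∷ cs) k = component-left c λ r u e ds →
  reflectSeq Δ (m+n≡0⇒m≡0 (outs Δ) i) ds λ r' δ →
  reflectSeq Γ (m+n≡0⇒n≡0 (outs Δ) i) (covs-mono (⊑-trans r r') cs) λ r'' γ →
  k (⊑-trans (⊑-trans r r') r'')
    ((_ , (η , to-edge (⊑-trans r' r'') e , adequate η) , Env-mono Δ r'' δ) , γ)

derivable-∼ : ∀ {S w} → Γ ∼ Δ → Derivable S w Γ → Derivable S w Δ
derivable-∼ {S = S} {w} e (derive D) =
  derive (exch (trans (GoalView.whole V _) (trans (⟪⟫-cong (GoalView.ctx V) e) (∼-sym (GoalView.whole V _)))) D)
  where V = goalView S w

derive-push : ∀ {S w} Θ Γ → InputSeq Θ → Derivable (push S w Θ) w Γ → Derivable S w (Θ ++ Γ)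
derive-push {S} {w} Θ Γ i (derive D) = derive (exch (trans (pushed V Θ Γ)
    (trans (≡⇒∼ (cong (λ Δ → GoalView.ctx V ⟪ Δ ++ Γ ⟫) (eraseOut-input Θ i))) (∼-sym (GoalView.whole V (Θ ++ Γ))))) D)
  where V = goalView S w

derive-extend : ∀ {S w η} Γ → Derivable (extend S w η []) zero Γ → Derivable S w [ [ η ∶ Γ ] ]
derive-extend {S} {w} {η} Γ (derive D) =
  derive (exch (trans (grown V η Γ) (∼-sym (GoalView.whole V _))) D)
  where V = goalView S w

pushed-cov : ∀ S w Θ → All (Cov (push S w Θ) w) Θ
pushed-cov S w Θ = All.tabulate λ m → here (∈-set S w (∈-++⁺ˡ m))

-- The recursion follows the path to the unique output. Input items are moved into the content of
-- the current node, and a component holding the output becomes a fresh child into which the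
-- recursion descends.
complete : ∀ Γ → NestedSeq Γ → ∀ {S w} →
  (∀ {S'} (r : S ⊑ S') v χ → Env Γ S' (to r w) v χ → S' ⊢ v ∶ χ) → Derivable S w Γ
complete ((• φ) ∷ Γ) i {S} {w} H = derive-push [ • φ ] Γ refl (complete Γ i λ r v χ γ →
  H (⊑-trans ⊑-push r) v χ (reflect φ (cov-mono r (All.head (pushed-cov S w [ • φ ]))) , γ))
-- The goal is chosen to be this output at its own node, so `reify φ` is the required continuation.
complete ((◦ φ) ∷ Γ) i {S} {w} H = derivable-∼ (↭⇒∼ (++-comm Γ [ ◦ φ ]))
  (derive-push Γ [ ◦ φ ] (suc-injective i) (reflectSeq Γ (suc-injective i) (pushed-cov S w Γ) λ r γ →
    H (⊑-trans ⊑-push r) _ φ ((λ r' a → reify φ a) , γ)))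
-- The count decides whether the output lies in this component; if it does, then `Γ` is input.
complete ([ η ∶ Δ ] ∷ Γ) i {S} {w} H with outs Δ in eq
... | zero = derive-push [ [ η ∶ Δ ] ] Γ (≡-trans (+-identityʳ _) eq) (complete Γ i λ r v χ γ →
  component-left (cov-mono r (All.head (pushed-cov S w [ [ η ∶ Δ ] ]))) λ r' u e ds →
  reflectSeq Δ eq ds λ r'' δ →
  H (⊑-trans ⊑-push (⊑-trans r (⊑-trans r' r''))) _ χ
    ((_ , (η , to-edge r'' e , adequate η) , δ) , Env-mono Γ (⊑-trans r' r'') γ))
... | suc m = derivable-∼ (↭⇒∼ (++-comm Γ [ [ η ∶ Δ ] ]))
  (derive-push Γ [ [ η ∶ Δ ] ] inputΓ (derive-extend Δ (complete Δ nestedΔ λ r v χ δ →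
    reflectSeq Γ inputΓ (covs-mono (⊑-trans ⊑-extend r) (pushed-cov S w Γ)) λ r' γ →
    H (⊑-trans ⊑-push (⊑-trans ⊑-extend (⊑-trans r r'))) _ χ
      ((_ , (η , to-edge (⊑-trans r r') new , adequate η) , Env-mono Δ r' δ) , γ))))
  where
  inputΓ : InputSeq Γ
  inputΓ = m+n≡0⇒n≡0 m (suc-injective i)
  nestedΔ : NestedSeq Δ
  nestedΔ = ≡-trans eq (cong suc (m+n≡0⇒m≡0 m (suc-injective i)))

theorem2 : (Γ : Seq) → NestedSeq Γ → ⊢[ withCut ] Γ → ⊢[ cutFree ] Γ
-- The start is a single empty node, whose erased content is the trailing empty list removed here.
theorem2 Γ i D = exch (≡⇒∼ (++-identityʳ Γ))
  (derivation (complete Γ i {world leaf (const [])} {zero} λ r v χ → sound i D))
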